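{- Let $n\ge 1$, let $a=(a_1,\ldots,a_n)$ and $b=(b_1,\ldots,b_n)$ be two $n$-tuples of positive integers, let $X$ be a non-empty subset of $\mathbb{N}\setminus\{0\}$ and let $g$ be a positive integer. Then the problem $\mathrm{P}(a,b,X,g)$ has a solution if and only if the (possibly infinite) cardinality of $\mathbb{N}\setminus M(a,b,X)$ is greater than or equal to $g$.
   Context: $\mathbb{N}$ is the set of non-negative integers. A solution of the problem $\mathrm{P}(a,b,X,g)$ is a subset $C$ of $\mathbb{N}\setminus\{0\}$ such that: (P1) the cardinality of $C$ is equal to $g$; (P2) if $x,y\in\mathbb{N}\setminus\{0\}$ and $x+y\in C$, then $C\cap\{x,y\}\neq\emptyset$; (P3) if $x\in C$ and $\frac{x-b_i}{a_i}\in\mathbb{N}\setminus\{0\}$ for some $i\in\{1,\ldots,n\}$, then $\frac{x-b_i}{a_i}\in C$; (P4) $X\cap C=\emptyset$. A numerical semigroup is a submonoid $S$ of $(\mathbb{N},+)$ with $\mathbb{N}\setminus S$ finite. For $s\in\mathbb{N}$, $as+b=(a_1s+b_1,\ldots,a_ns+b_n)$. $\mathcal{N}(a,b,X)$ is the set of all numerical semigroups $S$ such that $X\subseteq S$ and $as+b\in S^n$ for all $s\in S\setminus\{0\}$. $M(a,b,X)=\bigcap_{S\in\mathcal{N}(a,b,X)}S$ (note that $\mathbb{N}\in\mathcal{N}(a,b,X)$). -}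

module Defs where

open import Data.Fin using (Fin)
open import Data.Nat using (ℕ; _+_; _*_; _<_)
open import Data.Product using (Σ; ∃; proj₁)
open import Data.Vec.Functional using (Vector)
open import Function.Bundles using (Bijection; Injection)
open import Level using (Level; suc; 0ℓ)
open import Relation.Binary.Bundles using (Setoid)
import Relation.Binary.Construct.On as On
open import Relation.Binary.PropositionalEquality using (_≡_; setoid)
open import Relation.Unary
  using (Pred; _∈_; _⊆_; _∩_; _∪_; ｛_｝; ∁; ⋂; Satisfiable; Empty)

private
  variable
    ℓ : Level

-- A predicate A may have several proofs of A x, so elements of Σ ℕ A are
-- compared by their underlying number only; otherwise cardinalities would
-- count proofs.
Elements : Pred ℕ ℓ → Setoid ℓ 0ℓ
Elements A = On.setoid {B = Σ ℕ A} (setoid ℕ) proj₁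

HasCardinality : Pred ℕ ℓ → ℕ → Set ℓ
HasCardinality A k = Bijection (setoid (Fin k)) (Elements A)

Finite : Pred ℕ ℓ → Set ℓ
Finite A = ∃ λ k → HasCardinality A k

-- "The (possibly infinite) cardinality of A is at least k."
CardinalityAtLeast : Pred ℕ ℓ → ℕ → Set ℓ
CardinalityAtLeast A k = Injection (setoid (Fin k)) (Elements A)

record IsSolution {n : ℕ} (a b : Vector ℕ n) (X : Pred ℕ 0ℓ) (g : ℕ)
                  (C : Pred ℕ 0ℓ) : Set where
  field
    positive : C ⊆ (0 <_)
    P1 : HasCardinality C g
    P2 : ∀ x y → 0 < x → 0 < y → x + y ∈ C →
         Satisfiable (C ∩ (｛ x ｝ ∪ ｛ y ｝))
    -- y is the quotient (x - bᵢ) / aᵢ, unique since aᵢ > 0.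
    P3 : ∀ x i y → x ∈ C → 0 < y → x ≡ a i * y + b i → y ∈ C
    P4 : Empty (X ∩ C)

HasSolution : {n : ℕ} → Vector ℕ n → Vector ℕ n → Pred ℕ 0ℓ → ℕ → Set₁
HasSolution a b X g = Σ (Pred ℕ 0ℓ) (IsSolution a b X g)

record IsNumericalSemigroup (S : Pred ℕ 0ℓ) : Set where
  field
    0∈S      : 0 ∈ S
    +-closed : ∀ x y → x ∈ S → y ∈ S → x + y ∈ S
    cofinite : Finite (∁ S)

record 𝒩 {n : ℕ} (a b : Vector ℕ n) (X S : Pred ℕ 0ℓ) : Set where
  field
    isNumericalSemigroup : IsNumericalSemigroup S
    X⊆S                  : X ⊆ S
    affine-closed        : ∀ s → s ∈ S → 0 < s → ∀ i → a i * s + b i ∈ S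

M : {n : ℕ} → Vector ℕ n → Vector ℕ n → Pred ℕ 0ℓ → Pred ℕ (suc 0ℓ)
M a b X = ⋂ (Σ (Pred ℕ 0ℓ) (𝒩 a b X)) proj₁

{-# OPTIONS --safe #-}
-- Complements of solutions contain M, so a solution consists of g gaps of M.
-- Conversely, the closure L of X under 0, addition and the affine maps lies in
-- M, and every initial segment of the gaps of L satisfies (P2)-(P4) because
-- these conditions only refer to elements below the given one.  The size of the
-- initial segment below N grows by at most one with each N, hence takes the
-- value g as soon as there are g gaps.
--
-- Excluded middle is only available in Set, whereas M lives in Set₁; working
-- with the inductively defined L instead of M stays in Set.
module Submission where

open import Defs
open import Axiom.ExcludedMiddle using (ExcludedMiddle)
open import Data.Empty using (⊥-elim)
open import Data.Fin using (Fin; zero; suc)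
open import Data.Fin.Properties using (injective⇒≤)
open import Data.Nat using (ℕ; zero; suc; _+_; _*_; _≤_; _<_; s≤s; z<s; _⊔_; >-nonZero)
open import Data.Nat.Properties
  using (≤-<-trans; <-trans; <-≤-trans; <-irrefl; n<1+n;
         m<1+n⇒m<n∨m≡n; m≤n⇒m<n∨m≡n; n≤0⇒n≡0; m≤m+n; m≤n+m; m≤n*m; m≤m⊔n; m≤n⊔m;
         +-identityʳ; module ≤-Reasoning)
open import Data.Product using (∃; _×_; _,_; proj₁; proj₂)
open import Data.Sum using (inj₁; inj₂)
open import Data.Vec.Functional using (Vector)
open import Function using (_∘_)
open import Function.Bundles using (_⇔_; mk⇔; Bijection; Injection)
open import Level using (Level; 0ℓ)
open import Relation.Binary.PropositionalEquality using (_≡_; refl; sym; trans; cong; subst)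
open import Relation.Nullary using (yes; no)
open import Relation.Nullary.Decidable using (decidable-stable)
open import Relation.Unary
  using (Pred; Decidable; _∈_; _∉_; _⊆_; _≐_; _∩_; _∪_; ｛_｝; ∁; Empty; Satisfiable)

private
  variable
    ℓ ℓ′ : Level
    A : Pred ℕ ℓ
    B : Pred ℕ ℓ′
    k m n : ℕ

-- Cardinalities of sets of numbers.

HasCardinality-resp-≐ : A ≐ B → HasCardinality A k → HasCardinality B k
HasCardinality-resp-≐ (A⊆B , B⊆A) c = record
  { to        = λ i → proj₁ (to i) , A⊆B (proj₂ (to i))
  ; cong      = cong′
  ; bijective = injective , λ (y , y∈B) → surjective (y , B⊆A y∈B)
  }
  where open Bijection c renaming (cong to cong′)

HasCardinality-∅ : Empty A → HasCardinality A 0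
HasCardinality-∅ empty = record
  { to        = λ ()
  ; cong      = λ { {()} }
  ; bijective = (λ { {()} }) , λ (y , y∈A) → ⊥-elim (empty y y∈A)
  }

HasCardinality-insert : ∀ {x} → x ∉ A → HasCardinality A k →
                        HasCardinality (｛ x ｝ ∪ A) (suc k)
HasCardinality-insert {A = A} {k = k} {x = x} x∉A c = record
  { to        = to′
  ; cong      = λ { refl → refl }
  ; bijective = inj , surj
  }
  where
  open Bijection c using (to; injective; surjective)

  to′ : Fin (suc k) → ∃ (｛ x ｝ ∪ A)
  to′ zero    = x , inj₁ refl
  to′ (suc i) = proj₁ (to i) , inj₂ (proj₂ (to i))

  inj : ∀ {i j} → proj₁ (to′ i) ≡ proj₁ (to′ j) → i ≡ j
  inj {zero}  {zero}  _  = refl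
  inj {zero}  {suc j} eq = ⊥-elim (x∉A (subst A (sym eq) (proj₂ (to j))))
  inj {suc i} {zero}  eq = ⊥-elim (x∉A (subst A eq (proj₂ (to i))))
  inj {suc i} {suc j} eq = cong suc (injective eq)

  surj : ∀ y → ∃ λ i → ∀ {j} → j ≡ i → proj₁ (to′ j) ≡ proj₁ y
  surj (y , inj₁ refl) = zero , λ { refl → refl }
  surj (y , inj₂ y∈A)  =
    let (i , eq) = surjective (y , y∈A) in suc i , λ { refl → eq refl }

CardinalityAtLeast-⊆ : A ⊆ B → CardinalityAtLeast A k → CardinalityAtLeast B k
CardinalityAtLeast-⊆ A⊆B c = record
  { to        = λ i → proj₁ (to i) , A⊆B (proj₂ (to i))
  ; cong      = cong′
  ; injective = injective
  }
  where open Injection c renaming (cong to cong′)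

-- Looking up the `m` given elements in the enumeration of `A` yields a map `Fin m → Fin n`. Equal
-- indices force equal elements, so the pigeonhole principle applies.
CardinalityAtLeast⇒≤ : CardinalityAtLeast A m → HasCardinality A n → m ≤ n
CardinalityAtLeast⇒≤ c d = injective⇒≤ {f = index} λ {i} {j} eq →
  C.injective (trans (sym (to-index i)) (trans (cong (proj₁ ∘ D.to) eq) (to-index j)))
  where
  module C = Injection c
  module D = Bijection d

  index    = λ i → proj₁ (D.surjective (C.to i))
  to-index = λ i → proj₂ (D.surjective (C.to i)) refl

upperBound : (f : Fin k → ℕ) → ∃ λ N → ∀ i → f i < N
upperBound {zero}  f = 0 , λ ()
upperBound {suc k} f =
  let (N , f<N) = upperBound (f ∘ suc) in
  suc (f zero) ⊔ N , λ where
    zero    → m≤m⊔n (suc (f zero)) N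
    (suc i) → <-≤-trans (f<N i) (m≤n⊔m (suc (f zero)) N)

-- Initial segments of a set of numbers.

module _ {P : Pred ℕ ℓ} where

  -- Finitely many witnesses have a common bound, so even an infinite `P` can be replaced by a
  -- finite segment.
  CardinalityAtLeast-bounded : CardinalityAtLeast P k →
                               ∃ λ N → CardinalityAtLeast (P ∩ (_< N)) k
  CardinalityAtLeast-bounded c =
    let (N , <N) = upperBound (proj₁ ∘ to) in
    N , record
      { to        = λ i → proj₁ (to i) , proj₂ (to i) , <N i
      ; cong      = cong′
      ; injective = injective
      }
    where open Injection c renaming (cong to cong′)

  segment-suc-∉ : ∀ {N} → N ∉ P → (P ∩ (_< N)) ≐ (P ∩ (_< suc N))
  segment-suc-∉ {N} N∉P = (λ (p , x<N) → p , <-trans x<N (n<1+n N)) , shrink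
    where
    shrink : (P ∩ (_< suc N)) ⊆ (P ∩ (_< N))
    shrink (p , x<1+N) with m<1+n⇒m<n∨m≡n x<1+N
    ... | inj₁ x<N  = p , x<N
    ... | inj₂ refl = ⊥-elim (N∉P p)

  segment-suc-∈ : ∀ {N} → N ∈ P → (｛ N ｝ ∪ (P ∩ (_< N))) ≐ (P ∩ (_< suc N))
  segment-suc-∈ {N} N∈P = grow , shrink
    where
    grow : (｛ N ｝ ∪ (P ∩ (_< N))) ⊆ (P ∩ (_< suc N))
    grow (inj₁ refl)      = N∈P , n<1+n N
    grow (inj₂ (p , x<N)) = p , <-trans x<N (n<1+n N)

    shrink : (P ∩ (_< suc N)) ⊆ (｛ N ｝ ∪ (P ∩ (_< N)))
    shrink (p , x<1+N) with m<1+n⇒m<n∨m≡n x<1+N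
    ... | inj₁ x<N  = inj₂ (p , x<N)
    ... | inj₂ refl = inj₁ refl

  -- A discrete intermediate value theorem: raising the bound by one adds at most one element, so no
  -- size is skipped. The last clause carries this through the induction.
  segment-cardinalities : Decidable P → ∀ N → ∃ λ k →
    HasCardinality (P ∩ (_< N)) k ×
    (∀ j → j ≤ k → ∃ λ N′ → HasCardinality (P ∩ (_< N′)) j)
  segment-cardinalities P? zero =
    0 , empty , λ j j≤0 → 0 , subst (HasCardinality _) (sym (n≤0⇒n≡0 j≤0)) empty
    where
    empty : HasCardinality (P ∩ (_< 0)) 0
    empty = HasCardinality-∅ λ { _ (_ , ()) }
  segment-cardinalities P? (suc N) with segment-cardinalities P? N | P? N
  ... | k , c , smaller | no N∉P =
    k , HasCardinality-resp-≐ (segment-suc-∉ N∉P) c , smaller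
  ... | k , c , smaller | yes N∈P = suc k , c′ , smaller′
    where
    c′ : HasCardinality (P ∩ (_< suc N)) (suc k)
    c′ = HasCardinality-resp-≐ (segment-suc-∈ N∈P)
           (HasCardinality-insert (<-irrefl refl ∘ proj₂) c)

    smaller′ : ∀ j → j ≤ suc k → ∃ λ N′ → HasCardinality (P ∩ (_< N′)) j
    smaller′ j j≤1+k with m≤n⇒m<n∨m≡n j≤1+k
    ... | inj₁ (s≤s j≤k) = smaller j j≤k
    -- The only new size is `suc k`, attained by the current segment itself.
    ... | inj₂ refl               = suc N , c′

  segment-of-cardinality : Decidable P → CardinalityAtLeast P k →
                           ∃ λ N → HasCardinality (P ∩ (_< N)) k
  segment-of-cardinality {k = k} P? c =
    let (N , c<N)         = CardinalityAtLeast-bounded c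
        (_ , d , smaller) = segment-cardinalities P? N
    in smaller k (CardinalityAtLeast⇒≤ c<N d)

-- The generated set, and the passage between solutions and semigroups.

data Closure {n : ℕ} (a b : Vector ℕ n) (X : Pred ℕ 0ℓ) : Pred ℕ 0ℓ where
  base   : X ⊆ Closure a b X
  zero   : Closure a b X 0
  add    : ∀ {x y} → x ∈ Closure a b X → y ∈ Closure a b X → x + y ∈ Closure a b X
  affine : ∀ {s} → s ∈ Closure a b X → 0 < s → ∀ i → a i * s + b i ∈ Closure a b X

module _ {n : ℕ} {a b : Vector ℕ n} {X : Pred ℕ 0ℓ} where

  Closure⊆𝒩 : ∀ {S} → 𝒩 a b X S → Closure a b X ⊆ S
  Closure⊆𝒩 {S} S∈𝒩 = go
    where
    open 𝒩 S∈𝒩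
    open IsNumericalSemigroup isNumericalSemigroup

    go : Closure a b X ⊆ S
    go (base x∈X)       = X⊆S x∈X
    go zero             = 0∈S
    go (add x y)        = +-closed _ _ (go x) (go y)
    go (affine s 0<s i) = affine-closed _ (go s) 0<s i

  -- The closure may have infinitely many gaps and so fail to lie in `𝒩`; it is nevertheless
  -- contained in every member.
  Closure⊆M : Closure a b X ⊆ M a b X
  Closure⊆M x∈L (_ , S∈𝒩) = Closure⊆𝒩 S∈𝒩 x∈L

  complement-∈𝒩 : ExcludedMiddle 0ℓ → ∀ {g C} →
                  IsSolution a b X g C → 𝒩 a b X (∁ C)
  complement-∈𝒩 em {g} {C} sol = record
    { isNumericalSemigroup = record
      { 0∈S      = <-irrefl refl ∘ positive
      ; +-closed = +-closed
      -- The gaps of `∁ C` form `∁ (∁ C)`, which excluded middle identifies with `C`, counted by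
      -- `P1`.
      ; cofinite = g , HasCardinality-resp-≐ ((λ x∈C x∉C → x∉C x∈C) , decidable-stable em) P1
      }
    ; X⊆S           = λ x∈X x∈C → P4 _ (x∈X , x∈C)
    ; affine-closed = λ s s∉C 0<s i image∈C → s∉C (P3 _ i s image∈C 0<s refl)
    }
    where
    open IsSolution sol

    +-closed : ∀ x y → x ∉ C → y ∉ C → x + y ∉ C
    -- `P2` speaks of positive summands only, so zero summands are split off.
    +-closed zero    y       x∉C y∉C s∈C = y∉C s∈C
    +-closed (suc x) zero    x∉C y∉C s∈C = x∉C (subst C (+-identityʳ (suc x)) s∈C)
    +-closed (suc x) (suc y) x∉C y∉C s∈C with P2 (suc x) (suc y) z<s z<s s∈C
    ... | _ , z∈C , inj₁ refl = x∉C z∈C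
    ... | _ , z∈C , inj₂ refl = y∉C z∈C

  -- (P2) and (P3) are contrapositives of `add` and `affine`. Truncation at any `N` is harmless,
  -- since a summand or an affine preimage never exceeds the number it comes from.
  segment-isSolution : ExcludedMiddle 0ℓ → (∀ i → 0 < a i) → ∀ {g N} →
    HasCardinality (∁ (Closure a b X) ∩ (_< N)) g →
    IsSolution a b X g (∁ (Closure a b X) ∩ (_< N))
  segment-isSolution em 0<a {g} {N} c = record
    { positive = λ { {zero} (0∉L , _) → ⊥-elim (0∉L zero) ; {suc _} _ → z<s }
    ; P1       = c
    ; P2       = P2
    ; P3       = P3
    ; P4       = λ _ (x∈X , x∉L , _) → x∉L (base x∈X)
    }
    where
    C : Pred ℕ 0ℓ
    C = ∁ (Closure a b X) ∩ (_< N)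

    P2 : ∀ x y → 0 < x → 0 < y → x + y ∈ C → Satisfiable (C ∩ (｛ x ｝ ∪ ｛ y ｝))
    P2 x y _ _ (x+y∉L , x+y<N) with em {Closure a b X x}
    ... | no x∉L  = x , (x∉L , ≤-<-trans (m≤m+n x y) x+y<N) , inj₁ refl
    -- With `x` in the closure, having `y` there too would force `x + y` into it.
    ... | yes x∈L = y , (x+y∉L ∘ add x∈L , ≤-<-trans (m≤n+m y x) x+y<N) , inj₂ refl

    P3 : ∀ x i y → x ∈ C → 0 < y → x ≡ a i * y + b i → y ∈ C
    P3 _ i y (x∉L , x<N) 0<y refl = (λ y∈L → x∉L (affine y∈L 0<y i)) , y<N
      where
      open ≤-Reasoning
      y<N : y < N
      y<N = begin-strict
        -- Positivity of `a i` keeps the preimage from exceeding its image.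
        y              ≤⟨ m≤n*m y (a i) {{>-nonZero (0<a i)}} ⟩
        a i * y        ≤⟨ m≤m+n (a i * y) (b i) ⟩
        a i * y + b i  <⟨ x<N ⟩
        N              ∎

theorem2p3 : ExcludedMiddle 0ℓ →
    ∀ (n : ℕ) → 1 ≤ n →
    (a b : Vector ℕ n) → (∀ i → 0 < a i) → (∀ i → 0 < b i) →
    (X : Pred ℕ 0ℓ) → Satisfiable X → X ⊆ (0 <_) →
    (g : ℕ) → 0 < g →
    HasSolution a b X g ⇔ CardinalityAtLeast (∁ (M a b X)) g
theorem2p3 em n _ a b 0<a _ X _ _ g _ = mk⇔ solution⇒gaps gaps⇒solution
  where
  solution⇒gaps : HasSolution a b X g → CardinalityAtLeast (∁ (M a b X)) g
  solution⇒gaps (C , sol) =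
    -- Since `∁ C` belongs to `𝒩`, every element of `M` avoids `C`.
    CardinalityAtLeast-⊆ (λ x∈C x∈M → x∈M (∁ C , complement-∈𝒩 em sol) x∈C)
      (Bijection.injection (IsSolution.P1 sol))

  gaps⇒solution : CardinalityAtLeast (∁ (M a b X)) g → HasSolution a b X g
  gaps⇒solution gaps =
    -- `Closure⊆M` turns gaps of `M` into gaps of the closure, where `em` decides membership.
    let (N , c) = segment-of-cardinality (λ _ → em)
                    (CardinalityAtLeast-⊆ (_∘ Closure⊆M) gaps)
    in ∁ (Closure a b X) ∩ (_< N) , segment-isSolution em 0<a c
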